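{- The only pair $(n,x)$ of positive integers with $n\geq 2$ satisfying $(3^{n}-2)(45^{n}-2)=x^{2}$ is $(n,x)=(2,119)$. -}

module Defs where

{-# OPTIONS --safe #-}

-- Modulo 4 the exponent must be even, n = 2m. Writing x / (3ⁿ - 2) in lowest terms gives
-- 3ⁿ - 2 = d q² and 45ⁿ - 2 = d p², so 3ᵐ and 45ᵐ both occur as u in solutions of
-- u² = 2 + d v². With (r , s) the least solution and D = d s², the solutions are the odd
-- powers (r + s√d)²ʲ⁺¹ / 2ʲ, namely (r U_j(D) , s V_j(D)) for polynomials U_j and V_j.
-- As r divides 3ᵐ and r ≠ 1, we have 3 ∣ r, whence D = 7 + 9f. If 3 ∣ U_j(D), then 3 divides
-- the exponent 2j + 1, so that U_j(D) is a multiple of U_1(D) = 1 + 2D = 3 (5 + 6f).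
-- Since 5 + 6f > 1 is prime to 3, U_j(D) is a power of 3 only if it is 1, so r = 3ᵐ and
-- 15ᵐ = U_j(D) for some j. If m ≥ 2, cubing the least solution twice produces factors
-- 5 + 6f and 5 + 6f′ of 15ᵐ prime to 3, hence both multiples of 5; but 5 ∣ 5 + 6f forces
-- 5 + 6f′ ≡ 4 modulo 5.
module Submission where

module NaturalNumbers where
  open import Data.Empty using (⊥-elim)
  open import Data.List using ([]; _∷_)
  open import Data.Nat
  open import Data.Nat.Coprimality as Coprimality using (Coprime; coprime?; coprime-divisor; coprime-/gcd)
  open import Data.Nat.DivMod using (m/n*n≡m)
  open import Data.Nat.Divisibility
  open import Data.Nat.GCD using (gcd; gcd[m,n]∣m; gcd[m,n]∣n; gcd[m,n]≢0)
  open import Data.Nat.Induction using (<-wellFounded)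
  open import Data.Nat.Primality using (Prime; prime?; prime⇒irreducible)
  open import Data.Nat.Properties
  open import Data.Nat.Tactic.RingSolver using (solve)
  open import Data.Product using (_×_; _,_; proj₁; proj₂; map; map₂; ∃; ∃₂)
  open import Data.Sum using (_⊎_; inj₁; inj₂; [_,_]′)
  open import Induction.WellFounded using (Acc; acc)
  open import Relation.Binary.PropositionalEquality
  open import Relation.Nullary using (¬_; Dec; yes; no; contradiction)
  open import Relation.Nullary.Decidable using (from-yes; from-no; decidable-stable)
  open ≤-Reasoning

  -- Elements of norm 2 in ℤ[√d] and their quotients by units

  sq-cancel-≤ : ∀ {m n} → m * m ≤ n * n → m ≤ n
  sq-cancel-≤ mm≤nn = ≮⇒≥ λ n<m → <⇒≱ (*-mono-< n<m n<m) mm≤nn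

  sq-cancel-≡ : ∀ {m n} → m * m ≡ n * n → m ≡ n
  sq-cancel-≡ eq = ≤-antisym (sq-cancel-≤ (≤-reflexive eq)) (sq-cancel-≤ (≤-reflexive (sym eq)))

  -- Encodes (x - y)² = z² without subtraction. Together with `sq-difference′` it gives the same
  -- equation for either order of x and y, in the form that `norm2-unit` takes.
  sq-difference : ∀ {x y z} → x ≡ y + z → x * x + y * y ≡ 2 * (x * y) + z * z
  sq-difference {y = y} {z} refl = solve (y ∷ z ∷ [])

  sq-difference′ : ∀ {x y z} → y ≡ x + z → x * x + y * y ≡ 2 * (x * y) + z * z
  sq-difference′ {x} {z = z} refl = solve (x ∷ z ∷ [])

  -- The norm u² - d v² of u + v√d is 2, written additively to stay in ℕ.
  record Norm2 (d u v : ℕ) : Set where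
    constructor norm2
    field square : u * u ≡ 2 + d * (v * v)
  open Norm2

  module _ {d u v a b} (h : Norm2 d u v) (h′ : Norm2 d a b) where
    norm2-v≤⇒u≤ : v ≤ b → u ≤ a
    norm2-v≤⇒u≤ v≤b = sq-cancel-≤ (begin
      u * u            ≡⟨ square h ⟩
      2 + d * (v * v)  ≤⟨ +-monoʳ-≤ 2 (*-monoʳ-≤ d (*-mono-≤ v≤b v≤b)) ⟩
      2 + d * (b * b)  ≡⟨ square h′ ⟨
      a * a            ∎)

    norm2-u≤⇒v≤ : .{{_ : NonZero d}} → u ≤ a → v ≤ b
    norm2-u≤⇒v≤ u≤a = sq-cancel-≤ (*-cancelˡ-≤ d (+-cancelˡ-≤ 2 _ _ (begin
      2 + d * (v * v)  ≡⟨ square h ⟨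
      u * u            ≤⟨ *-mono-≤ u≤a u≤a ⟩
      a * a            ≡⟨ square h′ ⟩
      2 + d * (b * b)  ∎)))

  norm2⇒>0 : ∀ {d u v} → Norm2 d u v → 0 < u
  norm2⇒>0 {u = suc _} _ = z<s
  norm2⇒>0 {u = zero} (norm2 ())

  -- a + b√d is, up to the signs of a and b, u + v√d times the conjugate of the unit E + k√d;
  -- expressing a and b only through their squares covers all signs at once.
  norm2-unit : ∀ {d E k u v a b} → E * E ≡ 1 + d * (k * k) → Norm2 d u v →
    (E * u) * (E * u) + (d * k * v) * (d * k * v) ≡ 2 * ((E * u) * (d * k * v)) + a * a →
    (E * v) * (E * v) + (k * u) * (k * u) ≡ 2 * ((E * v) * (k * u)) + b * b →
    Norm2 d a b
  norm2-unit {d} {E} {k} {u} {v} {a} {b} unit h eqa eqb = norm2 (+-cancelˡ-≡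
    (d * (v * v) + d * (d * (k * k) * (v * v)) + d * (k * k * (u * u))) _ _ (begin-equality
    d * (v * v) + d * (d * (k * k) * (v * v)) + d * (k * k * (u * u)) + a * a
      ≡⟨ solve (d ∷ k ∷ u ∷ v ∷ a ∷ []) ⟩
    a * a + d * ((1 + d * (k * k)) * (v * v) + (k * u) * (k * u))
      ≡⟨ cong (λ e → a * a + d * (e * (v * v) + (k * u) * (k * u))) unit ⟨
    a * a + d * (E * E * (v * v) + (k * u) * (k * u))
      ≡⟨ solve (d ∷ E ∷ k ∷ u ∷ v ∷ a ∷ []) ⟩
    a * a + d * ((E * v) * (E * v) + (k * u) * (k * u))
      ≡⟨ cong (λ e → a * a + d * e) eqb ⟩
    a * a + d * (2 * ((E * v) * (k * u)) + b * b)
      ≡⟨ solve (d ∷ E ∷ k ∷ u ∷ v ∷ a ∷ b ∷ []) ⟩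
    -- The cross term of `eqb` multiplied by d is the cross term of `eqa`, so `eqa` can be applied
    -- backwards.
    (2 * ((E * u) * (d * k * v)) + a * a) + d * (b * b)
      ≡⟨ cong (_+ d * (b * b)) eqa ⟨
    ((E * u) * (E * u) + (d * k * v) * (d * k * v)) + d * (b * b)
      ≡⟨ solve (d ∷ E ∷ k ∷ u ∷ v ∷ b ∷ []) ⟩
    (E * E * (u * u) + (d * k * v) * (d * k * v)) + d * (b * b)
      ≡⟨ cong (λ e → (e * (u * u) + (d * k * v) * (d * k * v)) + d * (b * b)) unit ⟩
    ((1 + d * (k * k)) * (u * u) + (d * k * v) * (d * k * v)) + d * (b * b)
      ≡⟨ solve (d ∷ k ∷ u ∷ v ∷ b ∷ []) ⟩
    d * (d * (k * k) * (v * v)) + d * (k * k * (u * u)) + (u * u + d * (b * b))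
      ≡⟨ cong (λ e → d * (d * (k * k) * (v * v)) + d * (k * k * (u * u)) + (e + d * (b * b))) (square h) ⟩
    d * (d * (k * k) * (v * v)) + d * (k * k * (u * u)) + (2 + d * (v * v) + d * (b * b))
      ≡⟨ solve (d ∷ k ∷ u ∷ v ∷ b ∷ []) ⟩
    d * (v * v) + d * (d * (k * k) * (v * v)) + d * (k * k * (u * u)) + (2 + d * (b * b)) ∎))

  -- Here a + b√d = (E - k√d)(u + v√d); as the unit has norm 1, multiplying by E + k√d recovers u +
  -- v√d.
  unit-inverse : ∀ {d E k u v a b} → E * E ≡ 1 + d * (k * k) →
    E * u ≡ d * k * v + a → E * v ≡ k * u + b →
    u ≡ E * a + d * (k * b) × v ≡ E * b + k * a
  unit-inverse {d} {E} {k} {u} {v} {a} {b} unit eqa eqb =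
    +-cancelˡ-≡ (E * (d * k * v) + d * k * (k * u)) _ _ (begin-equality
      E * (d * k * v) + d * k * (k * u) + u
        ≡⟨ solve (d ∷ E ∷ k ∷ u ∷ v ∷ []) ⟩
      (1 + d * (k * k)) * u + d * k * (E * v)
        ≡⟨ cong₂ (λ e f → e * u + d * k * f) (sym unit) eqb ⟩
      E * E * u + d * k * (k * u + b)
        ≡⟨ cong (_+ d * k * (k * u + b)) (*-assoc E E u) ⟩
      E * (E * u) + d * k * (k * u + b)
        ≡⟨ cong (λ e → E * e + d * k * (k * u + b)) eqa ⟩
      E * (d * k * v + a) + d * k * (k * u + b)
        ≡⟨ solve (d ∷ E ∷ k ∷ u ∷ v ∷ a ∷ b ∷ []) ⟩
      E * (d * k * v) + d * k * (k * u) + (E * a + d * (k * b)) ∎) ,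
    +-cancelˡ-≡ (E * (k * u) + k * (d * k * v)) _ _ (begin-equality
      E * (k * u) + k * (d * k * v) + v
        ≡⟨ solve (d ∷ E ∷ k ∷ u ∷ v ∷ []) ⟩
      (1 + d * (k * k)) * v + k * (E * u)
        ≡⟨ cong₂ (λ e f → e * v + k * f) (sym unit) eqa ⟩
      E * E * v + k * (d * k * v + a)
        ≡⟨ cong (_+ k * (d * k * v + a)) (*-assoc E E v) ⟩
      E * (E * v) + k * (d * k * v + a)
        ≡⟨ cong (λ e → E * e + k * (d * k * v + a)) eqb ⟩
      E * (k * u + b) + k * (d * k * v + a)
        ≡⟨ solve (d ∷ E ∷ k ∷ u ∷ v ∷ a ∷ b ∷ []) ⟩
      E * (k * u) + k * (d * k * v) + (E * b + k * a) ∎)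

  -- The case of a negative √d-coordinate: (E - k√d)(u + v√d) = a - b√d, and v is read off from (E +
  -- k√d)(a - b√d).
  unit-reflect : ∀ {d E k u v a b} → E * E ≡ 1 + d * (k * k) →
    E * u ≡ d * k * v + a → k * u ≡ E * v + b → v + E * b ≡ k * a
  unit-reflect {d} {E} {k} {u} {v} {a} {b} unit eqa eqb =
    +-cancelˡ-≡ (d * (k * k) * v) _ _ (begin-equality
      d * (k * k) * v + (v + E * b)  ≡⟨ solve (d ∷ E ∷ k ∷ v ∷ b ∷ []) ⟩
      (1 + d * (k * k)) * v + E * b  ≡⟨ cong (λ e → e * v + E * b) unit ⟨
      E * E * v + E * b              ≡⟨ solve (E ∷ v ∷ b ∷ []) ⟩
      E * (E * v + b)                ≡⟨ cong (E *_) eqb ⟨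
      E * (k * u)                    ≡⟨ solve (E ∷ k ∷ u ∷ []) ⟩
      k * (E * u)                    ≡⟨ cong (k *_) eqa ⟩
      k * (d * k * v + a)            ≡⟨ solve (d ∷ k ∷ v ∷ a ∷ []) ⟩
      d * (k * k) * v + k * a        ∎)

  -- For α = r + s√d and β = a + b√d of norm 2 with β ≥ α, the unit α²/2 times the
  -- conjugate of β is α²/β ≤ α; here v is its √d-coordinate.
  reflect-≤ : ∀ {d r s a b v} → Norm2 d r s → Norm2 d a b → 0 < s → s ≤ b →
    v + (1 + d * (s * s)) * b ≡ r * s * a → v ≤ s
  reflect-≤ {d} {r} {s} {a} {b} {v} h h′ s>0 s≤b eq =
    go (m≤n⇒∃[o]m+o≡n s≤b) (m≤n⇒∃[o]m+o≡n as≤rb)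
    where
    -- Since a² / b² = d + 2 / b² and r² / s² = d + 2 / s², s ≤ b gives a / b ≤ r / s.
    as≤rb : a * s ≤ r * b
    as≤rb = sq-cancel-≤ (begin
      a * s * (a * s)                          ≡⟨ solve (a ∷ s ∷ []) ⟩
      a * a * (s * s)                          ≡⟨ cong (_* (s * s)) (square h′) ⟩
      (2 + d * (b * b)) * (s * s)              ≡⟨ solve (b ∷ d ∷ s ∷ []) ⟩
      2 * (s * s) + d * (b * b) * (s * s)      ≤⟨ +-monoˡ-≤ _ (*-monoʳ-≤ 2 (*-mono-≤ s≤b s≤b)) ⟩
      2 * (b * b) + d * (b * b) * (s * s)      ≡⟨ solve (b ∷ d ∷ s ∷ []) ⟩
      (2 + d * (s * s)) * (b * b)              ≡⟨ cong (_* (b * b)) (square h) ⟨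
      r * r * (b * b)                          ≡⟨ solve (r ∷ b ∷ []) ⟩
      r * b * (r * b)                          ∎)

    go : (∃ λ e → s + e ≡ b) → (∃ λ c → a * s + c ≡ r * b) → v ≤ s
    -- With c = r b - a s and e = b - s one has v = b - r c, so v ≤ s amounts to e ≤ r c.
    go (e , refl) (c , rb≡) = +-cancelʳ-≤ (r * c) v s (begin
      v + r * c  ≡⟨ v+rc≡b ⟩
      s + e      ≤⟨ +-monoʳ-≤ s e≤rc ⟩
      s + r * c  ∎)
      where
      v+rc≡b : v + r * c ≡ s + e
      v+rc≡b = +-cancelˡ-≡ (r * (a * s)) _ _ (begin-equality
        r * (a * s) + (v + r * c)        ≡⟨ solve (r ∷ a ∷ s ∷ v ∷ c ∷ []) ⟩
        v + r * (a * s + c)              ≡⟨ cong (λ x → v + r * x) rb≡ ⟩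
        v + r * (r * (s + e))            ≡⟨ solve (v ∷ r ∷ s ∷ e ∷ []) ⟩
        v + r * r * (s + e)              ≡⟨ cong (λ x → v + x * (s + e)) (square h) ⟩
        v + (2 + d * (s * s)) * (s + e)  ≡⟨ solve (v ∷ d ∷ s ∷ e ∷ []) ⟩
        v + (1 + d * (s * s)) * (s + e) + (s + e)  ≡⟨ cong (_+ (s + e)) eq ⟩
        r * s * a + (s + e)              ≡⟨ solve (r ∷ a ∷ s ∷ e ∷ []) ⟩
        r * (a * s) + (s + e)            ∎)

      -- Both sides are r² b² - a² s² for b = s + e: inserting the norm equations leaves 2 (b² -
      -- s²), while the right side is its factorisation.
      product : 2 * (e * (s + s + e)) ≡ c * (r * (s + e) + a * s)
      product = +-cancelˡ-≡ (a * s * (a * s)) _ _ (begin-equality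
        a * s * (a * s) + 2 * (e * (s + s + e))   ≡⟨ solve (a ∷ s ∷ e ∷ []) ⟩
        a * a * (s * s) + 2 * (e * (s + s + e))   ≡⟨ cong (λ x → x * (s * s) + 2 * (e * (s + s + e))) (square h′) ⟩
        (2 + d * ((s + e) * (s + e))) * (s * s) + 2 * (e * (s + s + e))
          ≡⟨ solve (d ∷ s ∷ e ∷ []) ⟩
        (2 + d * (s * s)) * ((s + e) * (s + e))   ≡⟨ cong (_* ((s + e) * (s + e))) (square h) ⟨
        r * r * ((s + e) * (s + e))               ≡⟨ solve (r ∷ s ∷ e ∷ []) ⟩
        r * (s + e) * (r * (s + e))               ≡⟨ cong (λ x → x * x) rb≡ ⟨
        (a * s + c) * (a * s + c)                 ≡⟨ solve (a ∷ s ∷ c ∷ []) ⟩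
        a * s * (a * s) + c * ((a * s + c) + a * s)
          ≡⟨ cong (λ x → a * s * (a * s) + c * (x + a * s)) rb≡ ⟩
        a * s * (a * s) + c * (r * (s + e) + a * s) ∎)

      -- 2 e b ≤ 2 e (b + s) = c (r b + a s) ≤ 2 c r b, and 2 b cancels.
      e≤rc : e ≤ r * c
      e≤rc = *-cancelʳ-≤ e (r * c) (2 * (s + e)) {{>-nonZero (≤-trans (≤-trans s>0 (m≤m+n s e)) (m≤m+n _ _))}} (begin
        e * (2 * (s + e))              ≤⟨ *-monoʳ-≤ e (*-monoʳ-≤ 2 (+-monoˡ-≤ e (m≤m+n s s))) ⟩
        e * (2 * (s + s + e))          ≡⟨ solve (e ∷ s ∷ []) ⟩
        2 * (e * (s + s + e))          ≡⟨ product ⟩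
        c * (r * (s + e) + a * s)      ≤⟨ *-monoʳ-≤ c (+-monoʳ-≤ (r * (s + e)) (≤-trans (m≤m+n (a * s) c) (≤-reflexive rb≡))) ⟩
        c * (r * (s + e) + r * (s + e)) ≡⟨ solve (c ∷ r ∷ s ∷ e ∷ []) ⟩
        r * c * (2 * (s + e))          ∎)

  -- (r + s√d)²ʲ⁺¹ / 2ʲ = r (U D j) + s (V D j) √d when r² = 2 + d s² and D = d s².
  U V : ℕ → ℕ → ℕ
  U D zero    = 1
  U D (suc j) = (1 + D) * U D j + D * V D j
  V D zero    = 1
  V D (suc j) = (2 + D) * U D j + (1 + D) * V D j

  -- Descent to the least solution

  module MinimalSolution {d r s} .{{_ : NonZero d}} (h : Norm2 d r s)
    (minimal : ∀ {a b} → Norm2 d a b → r ≤ a) where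

    private
      D = d * (s * s)

    s>0 : 0 < s
    s>0 = n≢0⇒n>0 λ { refl → no-root r (trans (square h) (cong (2 +_) (*-zeroʳ d))) }
      where
      no-root : ∀ r → r * r ≢ 2
      no-root (suc (suc (suc _))) ()

    D>0 : 0 < D
    D>0 = *-mono-≤ (>-nonZero⁻¹ d) (*-mono-≤ s>0 s>0)

    -- The unit (r + s√d)² / 2 is (1 + D) + r s √d, because r² + d s² = 2 + 2D.
    unit : (1 + D) * (1 + D) ≡ 1 + d * (r * s * (r * s))
    unit = begin-equality
      (1 + d * (s * s)) * (1 + d * (s * s))      ≡⟨ solve (d ∷ s ∷ []) ⟩
      1 + d * ((2 + d * (s * s)) * (s * s))      ≡⟨ cong (λ x → 1 + d * (x * (s * s))) (square h) ⟨
      1 + d * (r * r * (s * s))                  ≡⟨ solve (d ∷ r ∷ s ∷ []) ⟩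
      1 + d * (r * s * (r * s))                  ∎

    -- Keeps the rational part of the quotient by the unit in ℕ. After squaring, each factor on the
    -- right exceeds its counterpart on the left, by 1 and by 2.
    shrink-u : ∀ {u v} → Norm2 d u v → d * (r * s) * v ≤ (1 + D) * u
    shrink-u {u} {v} hu = sq-cancel-≤ (begin
      d * (r * s) * v * (d * (r * s) * v)
        ≡⟨ solve (d ∷ r ∷ s ∷ v ∷ []) ⟩
      d * (r * s * (r * s)) * (d * (v * v))
        ≤⟨ *-mono-≤ (m≤n+m (d * (r * s * (r * s))) 1) (m≤n+m (d * (v * v)) 2) ⟩
      (1 + d * (r * s * (r * s))) * (2 + d * (v * v))
        ≡⟨ cong₂ _*_ unit (square hu) ⟨
      (1 + D) * (1 + D) * (u * u)
        ≡⟨ regroup (1 + D) ⟩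
      (1 + D) * u * ((1 + D) * u) ∎)
      where
      regroup : ∀ E → E * E * (u * u) ≡ E * u * (E * u)
      regroup E = solve (E ∷ u ∷ [])

    -- Multiplying r x + s y √d by the unit preserves the factors r and s; x and y then change by
    -- the recursion of `U` and `V`.
    expand-u : ∀ x y → (1 + d * (s * s)) * (r * x) + d * (r * s * (s * y))
                     ≡ r * ((1 + d * (s * s)) * x + d * (s * s) * y)
    expand-u x y = solve (d ∷ r ∷ s ∷ x ∷ y ∷ [])
    expand-v : ∀ x y → (1 + d * (s * s)) * (s * y) + r * s * (r * x)
                     ≡ s * ((2 + d * (s * s)) * x + (1 + d * (s * s)) * y)
    expand-v x y = begin-equality
      (1 + d * (s * s)) * (s * y) + r * s * (r * x)
        ≡⟨ solve (d ∷ r ∷ s ∷ x ∷ y ∷ []) ⟩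
      (1 + d * (s * s)) * (s * y) + s * (r * r * x)
        ≡⟨ cong (λ z → (1 + d * (s * s)) * (s * y) + s * (z * x)) (square h) ⟩
      (1 + d * (s * s)) * (s * y) + s * ((2 + d * (s * s)) * x)
        ≡⟨ solve (d ∷ s ∷ x ∷ y ∷ []) ⟩
      s * ((2 + d * (s * s)) * x + (1 + d * (s * s)) * y) ∎

    -- Divides u + v√d by the unit. If the quotient has √d-coordinate at least 0, it is the smaller
    -- solution, since 1 + D > 1. Otherwise its conjugate is at least r + s√d by minimality, and
    -- `reflect-≤` yields v ≤ s, so u ≤ r.
    descend : ∀ {u v} → Norm2 d u v → r < u → ∃₂ λ a b → Norm2 d a b × a < u ×
      u ≡ (1 + D) * a + d * (r * s * b) × v ≡ (1 + D) * b + r * s * a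
    descend {u} {v} hu r<u = go (m≤n⇒∃[o]m+o≡n (shrink-u hu)) (≤-total (r * s * u) ((1 + D) * v))
      where
      go : (∃ λ a → d * (r * s) * v + a ≡ (1 + D) * u) →
        r * s * u ≤ (1 + D) * v ⊎ (1 + D) * v ≤ r * s * u →
        ∃₂ λ a b → Norm2 d a b × a < u × u ≡ (1 + D) * a + d * (r * s * b) × v ≡ (1 + D) * b + r * s * a
      go (a , eqa) (inj₁ le) = a , b , ha , a<u , inverse
        where
        b = m≤n⇒∃[o]m+o≡n le .proj₁
        eqb : r * s * u + b ≡ (1 + D) * v
        eqb = m≤n⇒∃[o]m+o≡n le .proj₂
        ha : Norm2 d a b
        ha = norm2-unit {d} {1 + D} {r * s} {u} {v} unit hu
          (sq-difference (sym eqa)) (sq-difference (sym eqb))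
        inverse : u ≡ (1 + D) * a + d * (r * s * b) × v ≡ (1 + D) * b + r * s * a
        inverse = unit-inverse {d} {1 + D} {r * s} {u} {v} unit (sym eqa) (sym eqb)
        a<u : a < u
        a<u = begin-strict
          a                              <⟨ m<m*n a (1 + D) {{>-nonZero (norm2⇒>0 ha)}} (s≤s D>0) ⟩
          a * (1 + D)                    ≡⟨ *-comm a (1 + D) ⟩
          (1 + D) * a                    ≤⟨ m≤m+n _ _ ⟩
          (1 + D) * a + d * (r * s * b)  ≡⟨ inverse .proj₁ ⟨
          u                              ∎
      go (a , eqa) (inj₂ le) = contradiction (norm2-v≤⇒u≤ hu h v≤s) (<⇒≱ r<u)
        where
        b = m≤n⇒∃[o]m+o≡n le .proj₁
        eqb : (1 + D) * v + b ≡ r * s * u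
        eqb = m≤n⇒∃[o]m+o≡n le .proj₂
        ha : Norm2 d a b
        ha = norm2-unit {d} {1 + D} {r * s} {u} {v} unit hu
          (sq-difference (sym eqa)) (sq-difference′ {x = (1 + D) * v} (sym eqb))
        v≤s : v ≤ s
        v≤s = reflect-≤ h ha s>0 (norm2-u≤⇒v≤ h ha (minimal ha))
          (unit-reflect {d} {1 + D} {r * s} {u} {v} unit (sym eqa) (sym eqb))

    -- The descent stops at u ≤ r, where minimality leaves only (r , s), that is j = 0; each step
    -- undone raises j by one.
    solutions : ∀ {u v} → Norm2 d u v → ∃ λ j → u ≡ r * U D j × v ≡ s * V D j
    solutions hu = go (<-wellFounded _) hu
      where
      go : ∀ {u v} → Acc _<_ u → Norm2 d u v → ∃ λ j → u ≡ r * U D j × v ≡ s * V D j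
      step : ∀ {u v} → Acc _<_ u →
        (∃₂ λ a b → Norm2 d a b × a < u × u ≡ (1 + D) * a + d * (r * s * b) × v ≡ (1 + D) * b + r * s * a) →
        ∃ λ j → u ≡ r * U D j × v ≡ s * V D j
      go {u} {v} wf hu with u ≤? r
      ... | yes u≤r = 0 ,
        trans (≤-antisym u≤r (minimal hu)) (sym (*-identityʳ r)) ,
        trans (≤-antisym (norm2-u≤⇒v≤ hu h u≤r) (norm2-u≤⇒v≤ h hu (minimal hu))) (sym (*-identityʳ s))
      ... | no u≰r = step wf (descend hu (≰⇒> u≰r))
      step {u} {v} (acc rec) (a , b , ha , a<u , u≡ , v≡) = extend (go (rec a<u) ha)
        where
        extend : (∃ λ j → a ≡ r * U D j × b ≡ s * V D j) → ∃ λ j → u ≡ r * U D j × v ≡ s * V D j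
        extend (j , a≡ , b≡) = suc j ,
          trans u≡ (trans (cong₂ (λ x y → (1 + D) * x + d * (r * s * y)) a≡ b≡) (expand-u (U D j) (V D j))) ,
          trans v≡ (trans (cong₂ (λ x y → (1 + D) * x + r * s * y) b≡ a≡) (expand-v (U D j) (V D j)))

  -- Existence of a least solution

  norm2⇒v≤u : ∀ {d u v} .{{_ : NonZero d}} → Norm2 d u v → v ≤ u
  norm2⇒v≤u {d} {u} {v} h = sq-cancel-≤ (begin
    v * v            ≤⟨ m≤n*m (v * v) d ⟩
    d * (v * v)      ≤⟨ m≤n+m _ 2 ⟩
    2 + d * (v * v)  ≡⟨ square h ⟨
    u * u            ∎)

  -- Replaces u by a smaller solvable value as long as there is one. The bound v ≤ u turns each test
  -- into a finite search.
  minimal-solution : ∀ {d u v} .{{_ : NonZero d}} → Norm2 d u v →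
    ∃₂ λ r s → Norm2 d r s × (∀ {a b} → Norm2 d a b → r ≤ a)
  minimal-solution {d} {u} = go (<-wellFounded u)
    where
    solvable? : ∀ r → Dec (∃ λ s → s < suc r × r * r ≡ 2 + d * (s * s))
    solvable? r = anyUpTo? (λ s → r * r ≟ 2 + d * (s * s)) (suc r)
    go : ∀ {u v} → Acc _<_ u → Norm2 d u v →
      ∃₂ λ r s → Norm2 d r s × (∀ {a b} → Norm2 d a b → r ≤ a)
    go {u} {v} (acc rec) h with anyUpTo? solvable? u
    ... | yes (r , r<u , s , _ , hr) = go {v = s} (rec r<u) (norm2 hr)
    ... | no none = u , v , h ,
      λ ha → ≮⇒≥ λ a<u → none (_ , a<u , _ , s≤s (norm2⇒v≤u ha) , square ha)

  -- Cubing the least solution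

  tripled : ℕ → ℕ
  tripled D = D * ((3 + 2 * D) * (3 + 2 * D))

  -- Three steps are one multiplication by the cube of the unit (1 + D) + r s √d. Its rational part
  -- is `1 + tripled D`, where `tripled D` = d s′² for the √d-coordinate s′ = s (3 + 2D) of (r +
  -- s√d)³ / 2.
  UV-step³ : ∀ D j →
    U D (3 + j) ≡ (1 + tripled D) * U D j + D * (3 + 2 * D) * (1 + 2 * D) * V D j ×
    V D (3 + j) ≡ (2 + D) * (3 + 2 * D) * (1 + 2 * D) * U D j + (1 + tripled D) * V D j
  UV-step³ D j = cube-u (U D j) (V D j) , cube-v (U D j) (V D j)
    where
    cube-u : ∀ x y →
      (1 + D) * ((1 + D) * ((1 + D) * x + D * y) + D * ((2 + D) * x + (1 + D) * y))
        + D * ((2 + D) * ((1 + D) * x + D * y) + (1 + D) * ((2 + D) * x + (1 + D) * y))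
      ≡ (1 + D * ((3 + 2 * D) * (3 + 2 * D))) * x + D * (3 + 2 * D) * (1 + 2 * D) * y
    cube-u x y = solve (D ∷ x ∷ y ∷ [])
    cube-v : ∀ x y →
      (2 + D) * ((1 + D) * ((1 + D) * x + D * y) + D * ((2 + D) * x + (1 + D) * y))
        + (1 + D) * ((2 + D) * ((1 + D) * x + D * y) + (1 + D) * ((2 + D) * x + (1 + D) * y))
      ≡ (2 + D) * (3 + 2 * D) * (1 + 2 * D) * x + (1 + D * ((3 + 2 * D) * (3 + 2 * D))) * y
    cube-v x y = solve (D ∷ x ∷ y ∷ [])

  -- (r + s√d)³ / 2 = (1 + 2D) r + (3 + 2D) s√d for D = ds², so every third odd power
  -- of r + s√d is an odd power of its cube.
  UV-tripled : ∀ D i → U D (suc (i * 3)) ≡ (1 + 2 * D) * U (tripled D) i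
                     × V D (suc (i * 3)) ≡ (3 + 2 * D) * V (tripled D) i
  UV-tripled D zero = base-u , base-v
    where
    base-u : (1 + D) * 1 + D * 1 ≡ (1 + 2 * D) * 1
    base-u = solve (D ∷ [])
    base-v : (2 + D) * 1 + (1 + D) * 1 ≡ (3 + 2 * D) * 1
    base-v = solve (D ∷ [])
  UV-tripled D (suc i) = lift (U D (suc (i * 3))) (V D (suc (i * 3))) (UV-step³ D (suc (i * 3))) (UV-tripled D i)
    where
    factor-u : ∀ x y →
      (1 + D * ((3 + 2 * D) * (3 + 2 * D))) * ((1 + 2 * D) * x)
        + D * (3 + 2 * D) * (1 + 2 * D) * ((3 + 2 * D) * y)
      ≡ (1 + 2 * D) * ((1 + D * ((3 + 2 * D) * (3 + 2 * D))) * x + D * ((3 + 2 * D) * (3 + 2 * D)) * y)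
    factor-u x y = solve (D ∷ x ∷ y ∷ [])
    factor-v : ∀ x y →
      (2 + D) * (3 + 2 * D) * (1 + 2 * D) * ((1 + 2 * D) * x)
        + (1 + D * ((3 + 2 * D) * (3 + 2 * D))) * ((3 + 2 * D) * y)
      ≡ (3 + 2 * D) * ((2 + D * ((3 + 2 * D) * (3 + 2 * D))) * x + (1 + D * ((3 + 2 * D) * (3 + 2 * D))) * y)
    factor-v x y = solve (D ∷ x ∷ y ∷ [])
    lift : ∀ x y {u v} →
      u ≡ (1 + tripled D) * x + D * (3 + 2 * D) * (1 + 2 * D) * y ×
      v ≡ (2 + D) * (3 + 2 * D) * (1 + 2 * D) * x + (1 + tripled D) * y →
      x ≡ (1 + 2 * D) * U (tripled D) i × y ≡ (3 + 2 * D) * V (tripled D) i →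
      u ≡ (1 + 2 * D) * U (tripled D) (suc i) × v ≡ (3 + 2 * D) * V (tripled D) (suc i)
    lift _ _ (eu , ev) (refl , refl) =
      trans eu (factor-u (U (tripled D) i) (V (tripled D) i)) ,
      trans ev (factor-v (U (tripled D) i) (V (tripled D) i))

  -- For D = 1 + 3e the coefficient of `V` has the factor 1 + 2D = 3 (1 + 2e), and `1 + tripled D` ≡
  -- 26 ≡ 2 modulo 3.
  U-step³-mod-3 : ∀ e j → ∃ λ z → U (1 + 3 * e) (3 + j) ≡ 3 * z + 2 * U (1 + 3 * e) j
  U-step³-mod-3 e j =
    (8 + 45 * e + 72 * (e * e) + 36 * (e * e * e)) * U (1 + 3 * e) j
      + (1 + 3 * e) * (5 + 6 * e) * (1 + 2 * e) * V (1 + 3 * e) j ,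
    trans (UV-step³ (1 + 3 * e) j .proj₁) (reduce (U (1 + 3 * e) j) (V (1 + 3 * e) j))
    where
    reduce : ∀ x y →
      (1 + (1 + 3 * e) * ((3 + 2 * (1 + 3 * e)) * (3 + 2 * (1 + 3 * e)))) * x
        + (1 + 3 * e) * (3 + 2 * (1 + 3 * e)) * (1 + 2 * (1 + 3 * e)) * y
      ≡ 3 * ((8 + 45 * e + 72 * (e * e) + 36 * (e * e * e)) * x + (1 + 3 * e) * (5 + 6 * e) * (1 + 2 * e) * y)
        + 2 * x
    reduce x y = solve (e ∷ x ∷ y ∷ [])

  -- Values of `U` dividing powers of 3 or equal to powers of 15

  coprime-prime : ∀ {p n} → Prime p → ¬ p ∣ n → Coprime n p
  coprime-prime pp p∤n (i∣n , i∣p) with prime⇒irreducible pp i∣p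
  ... | inj₁ i≡1 = i≡1
  ... | inj₂ refl = contradiction i∣n p∤n

  coprime-* : ∀ {n a b} → Coprime n a → Coprime n b → Coprime n (a * b)
  coprime-* ca cb (i∣n , i∣ab) =
    cb (i∣n , coprime-divisor (λ (k∣i , k∣a) → ca (∣-trans k∣i i∣n , k∣a)) i∣ab)

  ∣^∧coprime⇒≡1 : ∀ {t c} n → t ∣ c ^ n → Coprime t c → t ≡ 1
  ∣^∧coprime⇒≡1 zero    t∣ _  = ∣1⇒≡1 t∣
  ∣^∧coprime⇒≡1 (suc n) t∣ co = ∣^∧coprime⇒≡1 n (coprime-divisor co t∣) co

  -- Modulo 3 the first three values are 1, 0, 2, and raising the index by 3 doubles them.
  3∣U⇒ : ∀ e j → 3 ∣ U (1 + 3 * e) j → ∃ λ i → j ≡ suc (i * 3)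
  3∣U⇒ e 0 3∣1 = contradiction 3∣1 (from-no (3 ∣? 1))
  3∣U⇒ e 1 _   = 0 , refl
  3∣U⇒ e 2 3∣U = contradiction (∣m+n∣m⇒∣n (subst (3 ∣_) (expand e) 3∣U) (m∣m*n (3 + 14 * e + 12 * (e * e)))) (from-no (3 ∣? 2))
    where
    expand : ∀ e → (1 + (1 + 3 * e)) * ((1 + (1 + 3 * e)) * 1 + (1 + 3 * e) * 1)
           + (1 + 3 * e) * ((2 + (1 + 3 * e)) * 1 + (1 + (1 + 3 * e)) * 1)
           ≡ 3 * (3 + 14 * e + 12 * (e * e)) + 2
    expand e = solve (e ∷ [])
  3∣U⇒ e (suc (suc (suc j))) 3∣U = map suc (cong (3 +_)) (3∣U⇒ e j (lower (U-step³-mod-3 e j) 3∣U))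
    where
    lower : ∀ {x y} → (∃ λ z → y ≡ 3 * z + 2 * x) → 3 ∣ y → 3 ∣ x
    lower (z , refl) 3∣y = coprime-divisor (from-yes (coprime? 3 2)) (∣m+n∣m⇒∣n 3∣y (m∣m*n z))

  -- For r = 3 (q + 1), D = 9 (q + 1)² - 2 = 7 + 9 (q² + 2q).
  3∣⇒D≡7[9] : ∀ {r D} → 3 ∣ r → r * r ≡ 2 + D → ∃ λ f → D ≡ 7 + 9 * f
  3∣⇒D≡7[9] (divides-refl zero)    ()
  3∣⇒D≡7[9] (divides-refl (suc q)) eq = q + q * suc q , +-cancelˡ-≡ 2 _ _ (trans (sym eq) (expand q))
    where
    expand : ∀ q → (1 + q) * 3 * ((1 + q) * 3) ≡ 2 + (7 + 9 * (q + q * (1 + q)))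
    expand q = solve (q ∷ [])

  -- The f′ with `tripled D` = 7 + 9f′ when D = 7 + 9f.
  next : ℕ → ℕ
  next f = 224 + 765 * f + 864 * (f * f) + 324 * (f * f * f)

  tripled-7[9] : ∀ {D} f → D ≡ 7 + 9 * f → tripled D ≡ 7 + 9 * next f
  tripled-7[9] f refl = expand f
    where
    expand : ∀ f → (7 + 9 * f) * ((3 + 2 * (7 + 9 * f)) * (3 + 2 * (7 + 9 * f)))
                 ≡ 7 + 9 * (224 + 765 * f + 864 * (f * f) + 324 * (f * f * f))
    expand f = solve (f ∷ [])

  -- The factor split off by cubing is 1 + 2D = 15 + 18f. The remaining factor is again a value of
  -- `U`, so the lemma can be applied to it in turn.
  3∣U⇒factor : ∀ {D} f j → D ≡ 7 + 9 * f → 3 ∣ U D j →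
    ∃ λ i → U D j ≡ 3 * ((5 + 6 * f) * U (tripled D) i)
  3∣U⇒factor {D} f j D≡ 3∣U =
    map₂ (λ {i} → factor {i}) (3∣U⇒ (2 + 3 * f) j (subst (λ x → 3 ∣ U x j) (trans D≡ (residue f)) 3∣U))
    where
    residue : ∀ f → 7 + 9 * f ≡ 1 + 3 * (2 + 3 * f)
    residue f = solve (f ∷ [])
    regroup : ∀ f x → (1 + 2 * (7 + 9 * f)) * x ≡ 3 * ((5 + 6 * f) * x)
    regroup f x = solve (f ∷ x ∷ [])
    factor : ∀ {i} → j ≡ suc (i * 3) → U D j ≡ 3 * ((5 + 6 * f) * U (tripled D) i)
    factor {i} j≡ = begin-equality
      U D j                                      ≡⟨ cong (U D) j≡ ⟩
      U D (suc (i * 3))                          ≡⟨ UV-tripled D i .proj₁ ⟩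
      (1 + 2 * D) * U (tripled D) i              ≡⟨ cong (λ x → (1 + 2 * x) * U (tripled D) i) D≡ ⟩
      (1 + 2 * (7 + 9 * f)) * U (tripled D) i    ≡⟨ regroup f (U (tripled D) i) ⟩
      3 * ((5 + 6 * f) * U (tripled D) i)        ∎

  prime[3] : Prime 3
  prime[3] = from-yes (prime? 3)

  prime[5] : Prime 5
  prime[5] = from-yes (prime? 5)

  coprime-5+6f-3 : ∀ f → Coprime (5 + 6 * f) 3
  coprime-5+6f-3 f = coprime-prime prime[3] λ 3∣ →
    contradiction (∣m+n∣m⇒∣n (subst (3 ∣_) (expand f) 3∣) (m∣m*n (1 + 2 * f))) (from-no (3 ∣? 2))
    where
    expand : ∀ f → 5 + 6 * f ≡ 3 * (1 + 2 * f) + 2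
    expand f = solve (f ∷ [])

  -- The assumption gives 5 ∣ f, so `next f` ≡ 224 modulo 5, and 5 + 6 · 224 = 5 · 269 + 4.
  5∤next : ∀ f → 5 ∣ 5 + 6 * f → ¬ 5 ∣ 5 + 6 * next f
  5∤next f 5∣ = multiple {f} (coprime-divisor (from-yes (coprime? 5 6)) (∣m+n∣m⇒∣n 5∣ ∣-refl))
    where
    expand : ∀ g → 5 + 6 * (224 + 765 * (g * 5) + 864 * (g * 5 * (g * 5)) + 324 * (g * 5 * (g * 5) * (g * 5)))
                 ≡ 5 * (269 + 6 * (765 * g + 864 * g * (g * 5) + 324 * g * (g * 5) * (g * 5))) + 4
    expand g = solve (g ∷ [])
    multiple : ∀ {f} → 5 ∣ f → ¬ 5 ∣ 5 + 6 * next f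
    multiple (divides-refl g) 5∣next = contradiction
      (∣m+n∣m⇒∣n (subst (5 ∣_) (expand g) 5∣next)
        (m∣m*n (269 + 6 * (765 * g + 864 * g * (g * 5) + 324 * g * (g * 5) * (g * 5)))))
      (from-no (5 ∣? 4))

  45^≡3^*15^ : ∀ m → 45 ^ m ≡ 3 ^ m * 15 ^ m
  45^≡3^*15^ zero    = refl
  45^≡3^*15^ (suc m) = trans (cong (45 *_) (45^≡3^*15^ m)) (regroup (3 ^ m) (15 ^ m))
    where
    regroup : ∀ x y → 45 * (x * y) ≡ 3 * x * (15 * y)
    regroup x y = solve (x ∷ y ∷ [])

  5+6f≢1 : ∀ f → 5 + 6 * f ≢ 1
  5+6f≢1 f ()

  ∣3^⇒3∣ : ∀ {n} m → n ∣ 3 ^ m → n ≢ 1 → 3 ∣ n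
  ∣3^⇒3∣ {n} m n∣ n≢1 = decidable-stable (3 ∣? n)
    λ 3∤n → n≢1 (∣^∧coprime⇒≡1 m n∣ (coprime-prime prime[3] 3∤n))

  U∣3^⇒≡1 : ∀ {D} f j m → D ≡ 7 + 9 * f → U D j ∣ 3 ^ m → U D j ≡ 1
  U∣3^⇒≡1 {D} f j m D≡ U∣ = decidable-stable (U D j ≟ 1) λ U≢1 →
    absurd (3∣U⇒factor f j D≡ (∣3^⇒3∣ m U∣ U≢1))
    where
    absurd : ¬ ∃ λ i → U D j ≡ 3 * ((5 + 6 * f) * U (tripled D) i)
    absurd (i , U≡) = 5+6f≢1 f (∣^∧coprime⇒≡1 m
      (∣-trans (∣n⇒∣m*n 3 (m∣m*n (U (tripled D) i))) (subst (_∣ 3 ^ m) U≡ U∣))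
      (coprime-5+6f-3 f))

  15^≡U⇒m≡0 : ∀ {D} f j m → D ≡ 7 + 9 * f → 15 ^ suc m ≡ U D j → m ≡ 0
  15^≡U⇒m≡0 f j zero _ _ = refl
  15^≡U⇒m≡0 {D} f j (suc m) D≡ 15^≡ =
    ⊥-elim (absurd (3∣U⇒factor f j D≡ (subst (3 ∣_) 15^≡ (∣m⇒∣m*n (15 ^ suc m) (from-yes (3 ∣? 15))))))
    where
    -- Being prime to 3, 5 + 6f would be prime to 15 without a factor 5, hence equal to 1.
    only-5 : ∀ f → 5 + 6 * f ∣ 15 ^ suc (suc m) → 5 ∣ 5 + 6 * f
    only-5 f t∣ = decidable-stable (5 ∣? 5 + 6 * f) λ 5∤ → 5+6f≢1 f
      (∣^∧coprime⇒≡1 (suc (suc m)) t∣ (coprime-* (coprime-5+6f-3 f) (coprime-prime prime[5] 5∤)))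
    -- The exponent is at least 2, so 15² = 3 · 3 · 25 supplies a second 3 after one is cancelled; 5
    -- + 6f cannot take it, so `U (tripled D) i` does.
    regroup : ∀ x → 15 * (15 * x) ≡ 3 * (3 * (25 * x))
    regroup x = solve (x ∷ [])

    absurd : ¬ ∃ λ i → U D j ≡ 3 * ((5 + 6 * f) * U (tripled D) i)
    absurd (i , U≡) = absurd′ (3∣U⇒factor (next f) i (tripled-7[9] f D≡) 3∣U′)
      where
      15^≡tU′ : 15 ^ suc (suc m) ≡ 3 * ((5 + 6 * f) * U (tripled D) i)
      15^≡tU′ = trans 15^≡ U≡
      3∣U′ : 3 ∣ U (tripled D) i
      3∣U′ = coprime-divisor (Coprimality.sym (coprime-5+6f-3 f))
        (subst (3 ∣_) (*-cancelˡ-≡ _ _ 3 (trans (sym (regroup (15 ^ m))) 15^≡tU′)) (m∣m*n (25 * 15 ^ m)))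
      absurd′ : ¬ ∃ λ k → U (tripled D) i ≡ 3 * ((5 + 6 * next f) * U (tripled (tripled D)) k)
      absurd′ (k , U′≡) = 5∤next f
        (only-5 f (subst (5 + 6 * f ∣_) (sym 15^≡tU′) (∣n⇒∣m*n 3 (m∣m*n (U (tripled D) i)))))
        (only-5 (next f) (subst (5 + 6 * next f ∣_) (sym 15^≡tU′)
          (∣n⇒∣m*n 3 (∣n⇒∣m*n (5 + 6 * f) (subst (5 + 6 * next f ∣_) (sym U′≡)
            (∣n⇒∣m*n 3 (m∣m*n (U (tripled (tripled D)) k))))))))

  -- The exponent for a common d, and the origin of d

  common-norm2 : ∀ {d y z} m .{{_ : NonZero d}} → Norm2 d (3 ^ suc m) y → Norm2 d (45 ^ suc m) z → m ≡ 0
  common-norm2 {d} m hy hz = from-minimal (minimal-solution hy)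
    where
    from-minimal : (∃₂ λ r s → Norm2 d r s × (∀ {a b} → Norm2 d a b → r ≤ a)) → m ≡ 0
    from-minimal (r , s , h , minimal) =
      conclude (3∣⇒D≡7[9] (∣3^⇒3∣ (suc m) r∣3^ λ { refl → r≢1 h }) (square h))
        (solutions h minimal hy) (solutions h minimal hz)
      where
      open MinimalSolution
      D = d * (s * s)
      r≢1 : ¬ Norm2 d 1 s
      r≢1 (norm2 ())
      r∣3^ : r ∣ 3 ^ suc m
      r∣3^ = r∣ (solutions h minimal hy)
        where
        r∣ : ∀ {u v} → (∃ λ j → u ≡ r * U D j × v ≡ s * V D j) → r ∣ u
        r∣ (j , refl , _) = m∣m*n (U D j)
      conclude : ∀ {y z} → (∃ λ f → D ≡ 7 + 9 * f) →
        (∃ λ i → 3 ^ suc m ≡ r * U D i × y ≡ s * V D i) →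
        (∃ λ j → 45 ^ suc m ≡ r * U D j × z ≡ s * V D j) → m ≡ 0
      conclude (f , D≡) (i , 3^≡ , _) (j , 45^≡ , _) =
        -- As `U D i` = 1, the least solution has r equal to the power of 3; cancelling it leaves
        -- the power of 15.
        15^≡U⇒m≡0 f j m D≡ (*-cancelˡ-≡ _ _ (3 ^ suc m) {{m^n≢0 3 (suc m)}} (begin-equality
          3 ^ suc m * 15 ^ suc m  ≡⟨ 45^≡3^*15^ (suc m) ⟨
          45 ^ suc m              ≡⟨ 45^≡ ⟩
          r * U D j               ≡⟨ cong (_* U D j) 3^≡r ⟨
          3 ^ suc m * U D j       ∎))
        where
        3^≡r : 3 ^ suc m ≡ r
        3^≡r = begin-equality
          3 ^ suc m  ≡⟨ 3^≡ ⟩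
          r * U D i  ≡⟨ cong (r *_) (U∣3^⇒≡1 f i (suc m) D≡ (subst (U D i ∣_) (sym 3^≡) (n∣m*n r))) ⟩
          r * 1      ≡⟨ *-identityʳ r ⟩
          r          ∎

  -- With g = gcd x a, x = p g and a = q g, cancelling g leaves q b = p² g. As q is prime to p, it
  -- divides g, and d = g / q.
  square-product : ∀ {a b x} .{{_ : NonZero a}} → a * b ≡ x * x →
    ∃ λ d → ∃₂ λ p q → a ≡ d * (q * q) × b ≡ d * (p * p)
  square-product {a} {b} {x} ab≡xx = lowest-terms (coprime-/gcd x a)
    (sym (m/n*n≡m (gcd[m,n]∣m x a))) (sym (m/n*n≡m (gcd[m,n]∣n x a)))
    where
    instance
      gcd-nonZero : NonZero (gcd x a)
      gcd-nonZero = ≢-nonZero (gcd[m,n]≢0 x a (inj₂ (≢-nonZero⁻¹ a)))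
    lowest-terms : ∀ {p q} → Coprime p q → x ≡ p * gcd x a → a ≡ q * gcd x a →
      ∃ λ d → ∃₂ λ p q → a ≡ d * (q * q) × b ≡ d * (p * p)
    lowest-terms {p} {q} p⊥q x≡ a≡ = split q∣g
      where
      g = gcd x a
      qb≡ : q * b ≡ p * (p * g)
      qb≡ = *-cancelˡ-≡ _ _ g (begin-equality
        g * (q * b)        ≡⟨ *-assoc g q b ⟨
        g * q * b          ≡⟨ cong (_* b) (trans (*-comm g q) (sym a≡)) ⟩
        a * b              ≡⟨ ab≡xx ⟩
        x * x              ≡⟨ cong₂ _*_ x≡ x≡ ⟩
        p * g * (p * g)    ≡⟨ regroup p g ⟩
        g * (p * (p * g))  ∎)
        where
        regroup : ∀ p g → p * g * (p * g) ≡ g * (p * (p * g))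
        regroup p g = solve (p ∷ g ∷ [])
      q∣g : q ∣ g
      q∣g = coprime-divisor (Coprimality.sym p⊥q) (coprime-divisor (Coprimality.sym p⊥q)
        (subst (q ∣_) qb≡ (m∣m*n b)))
      split : q ∣ g → ∃ λ d → ∃₂ λ p q → a ≡ d * (q * q) × b ≡ d * (p * p)
      split (divides d g≡) = d , p , q ,
        trans a≡ (trans (cong (q *_) g≡) (regroup₁ q d)) ,
        *-cancelˡ-≡ _ _ q {{≢-nonZero q≢0}} (trans qb≡ (trans (cong (λ g → p * (p * g)) g≡) (regroup₂ p q d)))
        where
        q≢0 : q ≢ 0
        q≢0 refl = ≢-nonZero⁻¹ a a≡
        regroup₁ : ∀ q d → q * (d * q) ≡ d * (q * q)
        regroup₁ q d = solve (q ∷ d ∷ [])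
        regroup₂ : ∀ p q d → p * (p * (d * q)) ≡ q * (d * (p * p))
        regroup₂ p q d = solve (p ∷ q ∷ d ∷ [])

  -- Parity of the exponent

  even-or-odd : ∀ n → ∃ λ h → n ≡ h + h ⊎ n ≡ 1 + (h + h)
  even-or-odd zero = 0 , inj₁ refl
  even-or-odd (suc n) with even-or-odd n
  ... | h , inj₁ refl = h , inj₂ refl
  ... | h , inj₂ refl = suc h , inj₁ (cong suc (sym (+-suc h h)))

  x²≢3[4] : ∀ x c → x * x ≢ 4 * c + 3
  x²≢3[4] x c eq = [ even h , odd h ]′ (even-or-odd x .proj₂)
    where
    h = even-or-odd x .proj₁
    even : ∀ h → x ≢ h + h
    even h refl = contradiction
      (∣m+n∣m⇒∣n (subst (4 ∣_) (trans (sym (expand h)) eq) (m∣m*n (h * h))) (m∣m*n c)) (from-no (4 ∣? 3))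
      where
      expand : ∀ h → (h + h) * (h + h) ≡ 4 * (h * h)
      expand h = solve (h ∷ [])
    odd : ∀ h → x ≢ 1 + (h + h)
    odd h refl = contradiction
      (∣m+n∣m⇒∣n (subst (4 ∣_) (suc-injective (trans (sym (expand h)) (trans eq (+-suc (4 * c) 2)))) (m∣m*n (h + h * h)))
        (m∣m*n c)) (from-no (4 ∣? 2))
      where
      expand : ∀ h → (1 + (h + h)) * (1 + (h + h)) ≡ 1 + 4 * (h + h * h)
      expand h = solve (h ∷ [])

  even-power≡1[4] : ∀ {c} a h → c ≡ 1 + 2 * a → ∃ λ k → c ^ (h + h) ≡ 1 + 4 * k
  even-power≡1[4] {c} a h refl = power (oddp h)
    where
    oddp : ∀ h → ∃ λ k → (1 + 2 * a) ^ h ≡ 1 + 2 * k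
    oddp zero    = 0 , refl
    oddp (suc h) = map (λ k → a + k + 2 * (a * k)) (λ {k} eq → trans (cong ((1 + 2 * a) *_) eq) (expand a k)) (oddp h)
      where
      expand : ∀ a k → (1 + 2 * a) * (1 + 2 * k) ≡ 1 + 2 * (a + k + 2 * (a * k))
      expand a k = solve (a ∷ k ∷ [])
    power : (∃ λ k → (1 + 2 * a) ^ h ≡ 1 + 2 * k) → ∃ λ k → (1 + 2 * a) ^ (h + h) ≡ 1 + 4 * k
    power (k , eq) = k + k * k , trans (^-distribˡ-+-* (1 + 2 * a) h h) (trans (cong₂ _*_ eq eq) (expand k))
      where
      expand : ∀ k → (1 + 2 * k) * (1 + 2 * k) ≡ 1 + 4 * (k + k * k)
      expand k = solve (k ∷ [])

  -- Modulo 4 the factors are 3 - 2 = 1 and 45 - 2 ≡ 3, with product 3.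
  odd-impossible : ∀ {A B x} h → 3 ^ (1 + (h + h)) ≡ 2 + A → 45 ^ (1 + (h + h)) ≡ 2 + B → A * B ≢ x * x
  odd-impossible {A} {B} {x} h 3^≡ 45^≡ AB≡ =
    go (even-power≡1[4] 1 h refl) (even-power≡1[4] 22 h refl)
    where
    go : (∃ λ k → 3 ^ (h + h) ≡ 1 + 4 * k) → ¬ ∃ λ l → 45 ^ (h + h) ≡ 1 + 4 * l
    go (k , 9^≡) (l , 2025^≡) = x²≢3[4] x (3 * k * (43 + 180 * l) + (10 + 45 * l))
      (trans (sym AB≡) (trans (cong₂ _*_ A≡ B≡) (product k l)))
      where
      expand₁ : ∀ k → 3 * (1 + 4 * k) ≡ 2 + (1 + 4 * (3 * k))
      expand₁ k = solve (k ∷ [])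
      expand₂ : ∀ l → 45 * (1 + 4 * l) ≡ 2 + (43 + 180 * l)
      expand₂ l = solve (l ∷ [])
      A≡ : A ≡ 1 + 4 * (3 * k)
      A≡ = +-cancelˡ-≡ 2 _ _ (trans (sym 3^≡) (trans (cong (3 *_) 9^≡) (expand₁ k)))
      B≡ : B ≡ 43 + 180 * l
      B≡ = +-cancelˡ-≡ 2 _ _ (trans (sym 45^≡) (trans (cong (45 *_) 2025^≡) (expand₂ l)))
      product : ∀ k l → (1 + 4 * (3 * k)) * (43 + 180 * l) ≡ 4 * (3 * k * (43 + 180 * l) + (10 + 45 * l)) + 3
      product k l = solve (k ∷ l ∷ [])

  -- The solution over ℕ

  only-solution : ∀ n {A B x} → 2 ≤ n → 3 ^ n ≡ 2 + A → 45 ^ n ≡ 2 + B → A * B ≡ x * x → n ≡ 2 × x ≡ 119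
  only-solution n {A} {B} {x} 2≤n 3^≡ 45^≡ AB≡ = [ even h , odd h ]′ (even-or-odd n .proj₂)
    where
    h = even-or-odd n .proj₁

    odd : ∀ h → n ≡ 1 + (h + h) → n ≡ 2 × x ≡ 119
    odd h refl = contradiction AB≡ (odd-impossible {x = x} h 3^≡ 45^≡)

    A≢0 : A ≢ 0
    A≢0 refl = <⇒≱ (from-yes (2 <? 9)) (≤-trans (^-monoʳ-≤ 3 2≤n) (≤-reflexive 3^≡))

    even : ∀ h → n ≡ h + h → n ≡ 2 × x ≡ 119
    even zero refl = contradiction 2≤n λ ()
    even (suc m) n≡ = conclude (square-product {x = x} {{≢-nonZero A≢0}} AB≡)
      where
      conclude : (∃ λ d → ∃₂ λ p q → A ≡ d * (q * q) × B ≡ d * (p * p)) → n ≡ 2 × x ≡ 119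
      conclude (d , p , q , A≡ , B≡) = n≡2 , sq-cancel-≡ (trans (sym AB≡) (values n≡2))
        where
        norm : ∀ c {C} v → c ^ n ≡ 2 + C → C ≡ d * (v * v) → Norm2 d (c ^ suc m) v
        norm c v c^≡ C≡ = norm2 (trans (sym (^-distribˡ-+-* c (suc m) (suc m)))
          (trans (cong (c ^_) (sym n≡)) (trans c^≡ (cong (2 +_) C≡))))
        m≡0 : m ≡ 0
        m≡0 = common-norm2 m {{≢-nonZero λ { refl → A≢0 A≡ }}} (norm 3 q 3^≡ A≡) (norm 45 p 45^≡ B≡)
        n≡2 : n ≡ 2
        n≡2 = trans n≡ (cong (λ m → suc m + suc m) m≡0)
        -- 3² - 2 = 7 and 45² - 2 = 2023 = 7 · 17², so the product is (7 · 17)².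
        values : n ≡ 2 → A * B ≡ 119 * 119
        values refl = cong₂ _*_ (+-cancelˡ-≡ 2 A 7 (sym 3^≡)) (+-cancelˡ-≡ 2 B 2023 (sym 45^≡))

-- Transfer to ℤ

open import Data.Nat using (ℕ; _≥_)
open import Data.Integer using (+_; _-_; _*_; _^_)
open import Data.Product using (_×_; _,_)
open import Function.Bundles using (_⇔_; mk⇔)
open import Relation.Binary.PropositionalEquality using (_≡_; refl; sym; trans; cong; cong₂)
open import Defs
import Data.Integer.Properties as ℤ
import Data.Nat as ℕ
import Data.Nat.Properties as ℕ
open import Data.Product using (∃)
open import Relation.Nullary.Decidable using (from-yes)

pos-^ : ∀ a n → (+ a) ^ n ≡ + (a ℕ.^ n)
pos-^ a ℕ.zero    = refl
pos-^ a (ℕ.suc n) = trans (cong (+ a *_) (pos-^ a n)) (sym (ℤ.pos-* a (a ℕ.^ n)))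

-- Once the power has the form 2 + A, the integer subtraction computes to `+ A`.
pos-^-minus-2 : ∀ a n {A} → 2 ℕ.+ A ≡ a ℕ.^ n → (+ a) ^ n - + 2 ≡ + A
pos-^-minus-2 a n eq = cong (_- + 2) (trans (pos-^ a n) (cong +_ (sym eq)))

excess : ∀ {a n} → n ≥ 2 → a ≥ 2 → ∃ λ A → 2 ℕ.+ A ≡ a ℕ.^ n
excess {a} {n} n≥2 a≥2 = ℕ.m≤n⇒∃[o]m+o≡n
  (ℕ.≤-trans (from-yes (2 ℕ.≤? 2 ℕ.^ 2)) (ℕ.≤-trans (ℕ.^-monoʳ-≤ 2 n≥2) (ℕ.^-monoˡ-≤ n a≥2)))

theorem30 : ∀ (n x : ℕ) →
    (n ≥ 2 × x ≥ 1 × ((+ 3) ^ n - (+ 2)) * ((+ 45) ^ n - (+ 2)) ≡ (+ x) ^ 2) ⇔ ((n , x) ≡ (2 , 119))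
theorem30 n x = mk⇔ to λ { refl → from-yes (2 ℕ.≤? 2) , from-yes (1 ℕ.≤? 119) , refl }
  where
  to : n ≥ 2 × x ≥ 1 × ((+ 3) ^ n - (+ 2)) * ((+ 45) ^ n - (+ 2)) ≡ (+ x) ^ 2 → (n , x) ≡ (2 , 119)
  to (n≥2 , _ , eq) = solution (excess n≥2 (from-yes (2 ℕ.≤? 3))) (excess n≥2 (from-yes (2 ℕ.≤? 45)))
    where
    solution : (∃ λ A → 2 ℕ.+ A ≡ 3 ℕ.^ n) → (∃ λ B → 2 ℕ.+ B ≡ 45 ℕ.^ n) → (n , x) ≡ (2 , 119)
    solution (A , A≡) (B , B≡) = pair (NaturalNumbers.only-solution n n≥2 (sym A≡) (sym B≡)
      (trans (ℤ.+-injective product) (cong (x ℕ.*_) (ℕ.*-identityʳ x))))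
      where
      product : + (A ℕ.* B) ≡ + (x ℕ.^ 2)
      product = trans (ℤ.pos-* A B)
        (trans (sym (cong₂ _*_ (pos-^-minus-2 3 n A≡) (pos-^-minus-2 45 n B≡))) (trans eq (pos-^ x 2)))
      pair : n ≡ 2 × x ≡ 119 → (n , x) ≡ (2 , 119)
      pair (n≡ , x≡) = cong₂ _,_ n≡ x≡
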